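{- Let $n \ge 1$ and $\ell \ge 2$ be integers, and let $x=(x_1,\dots,x_n)\in\mathbb{Z}^n$ satisfy $x_1\le\dots\le x_n$ and have at least one entry that is a multiple of $\ell$. Let $x'$ be obtained from $x$ by a finite sequence of successive GM-moves. Then: (i) if $\mathrm{range}(x)\le \ell$, then $\mathrm{range}(x')\le\ell$; (ii) $\mathrm{range}(x')-\mathrm{range}(x)\le \ell$.
   Context: Notation: $[n]=\{1,\dots,n\}$. Entries of vectors are integers and may be negative; $0$ and negative multiples count as multiples of $\ell$. For a vector with $x_1\le\dots\le x_n$, $\mathrm{range}(x)=x_n-x_1$. Pivot: let $x=(x_1,\dots,x_n)$ be an integer vector with $x_1\le \dots\le x_n$ having at least one entry that is a multiple of $\ell$. Among the entries of $x$ that are multiples of $\ell$, take the minimal value; the pivot of $x$, $\mathrm{pivot}(x)\in[n]$, is the largest index $i$ such that $x_i$ equals this value. GM-move: the GM-move $x\to x'$ keeps the pivotal entry ($x'_i=x_i$ for $i=\mathrm{pivot}(x)$) and reduces each of the other $n-1$ entries by $1$ ($x'_k=x_k-1$ for $k\ne i$). The vector $x'$ again satisfies $x'_1\le\dots\le x'_n$ and has an entry that is a multiple of $\ell$, so GM-moves can be iterated. -}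

module Defs where

open import Data.Fin.Base as Fin using (Fin)
open import Data.Integer.Base using (ℤ; +_; _≤_; _-_; 1ℤ)
open import Data.Integer.Divisibility.Signed using (_∣_)
open import Data.Nat.Base using (ℕ; suc)
open import Data.Product.Base using (∃-syntax; _×_)
open import Data.Vec.Functional using (Vector; head; last)
open import Relation.Binary.Core using (Rel; _Preserves_⟶_)
open import Relation.Binary.Construct.Closure.ReflexiveTransitive using (Star)
open import Relation.Binary.PropositionalEquality.Core using (_≡_; _≢_)
open import Level using (0ℓ)

Sorted : {n : ℕ} → Vector ℤ n → Set
Sorted x = x Preserves Fin._≤_ ⟶ _≤_

HasMultiple : {n : ℕ} → ℕ → Vector ℤ n → Set
HasMultiple ℓ x = ∃[ i ] + ℓ ∣ x i

-- Intended for sorted vectors; a vector of length n ≥ 1 has type Vector ℤ (suc m).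
range : {m : ℕ} → Vector ℤ (suc m) → ℤ
range x = last x - head x

record IsPivot {n : ℕ} (ℓ : ℕ) (x : Vector ℤ n) (i : Fin n) : Set where
  field
    multiple : + ℓ ∣ x i
    minimal  : (j : Fin n) → + ℓ ∣ x j → x i ≤ x j
    largest  : (j : Fin n) → x j ≡ x i → j Fin.≤ i

-- Sortedness is not demanded here: moves preserve it, so it is only
-- imposed on the vector from which a sequence of moves starts.
GMMove : {n : ℕ} → ℕ → Rel (Vector ℤ n) 0ℓ
GMMove ℓ x x′ =
  ∃[ i ] IsPivot ℓ x i × x′ i ≡ x i × (∀ k → k ≢ i → x′ k ≡ x k - 1ℤ)

GMMoves : {n : ℕ} → ℕ → Rel (Vector ℤ n) 0ℓ
GMMoves ℓ = Star (GMMove ℓ)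

{-# OPTIONS --safe #-}
-- Two properties are tracked, for a bound B ≥ ℓ on the range. In the first, x₁ has not
-- yet passed a fixed multiple c of ℓ with c ≤ x₁, and xₙ ≤ c + B; no entry ever increases,
-- so this persists until x₁ = c. From then on some entry of x that is a multiple of ℓ is at
-- most x₁ + ℓ. This persists because the pivot cannot equal x₁ + ℓ while x₁ drops, as x₁
-- would be a smaller multiple. Now the range grows only when the last entry is the pivot,
-- and then it is at most ℓ after the move. Take B = ℓ for (i), and B = range x + ℓ with c
-- the largest multiple of ℓ not exceeding x₁ for (ii).
module Submission where

open import Defs
open import Data.Fin.Base using (Fin; fromℕ)
open import Data.Fin.Properties using (_≟_; ≤fromℕ)
open import Data.Integer.Base as ℤ using (ℤ; +_; _≤_; _<_; _+_; _-_; _*_; _/ℕ_; pred; 0ℤ; 1ℤ;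
  nonNegative)
open import Data.Integer.DivMod using ([n/ℕd]*d≤n; n<s[n/ℕd]*d)
open import Data.Integer.Divisibility.Signed using (_∣_; divides; ∣-refl; ∣m+n∣n⇒∣m)
open import Data.Integer.Properties as ℤ hiding (_≟_)
open import Data.Integer.Tactic.RingSolver using (solve-∀)
open import Data.Nat.Base as ℕ using (ℕ; suc; z≤n)
open import Data.Product.Base using (_×_; _,_; proj₁; proj₂)
open import Data.Sum.Base using (_⊎_; inj₁; inj₂; [_,_]′)
open import Data.Vec.Functional using (Vector; head; last)
open import Relation.Binary.Construct.Closure.ReflexiveTransitive using (ε; _◅_)
open import Relation.Binary.PropositionalEquality using (_≡_; _≢_; refl; sym; trans; cong; subst)
open import Relation.Nullary.Decidable.Core using (yes; no)

i≤j+k⇒i-j≤k : ∀ {i j k} → i ≤ j + k → i - j ≤ k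
i≤j+k⇒i-j≤k {i} {j} {k} i≤j+k = begin
  i - j        ≤⟨ +-monoˡ-≤ _ i≤j+k ⟩
  (j + k) - j  ≡⟨ cancel j k ⟩
  k            ∎
  where
  open ≤-Reasoning
  cancel : ∀ j k → (j + k) - j ≡ k
  cancel = solve-∀

i-j≤k⇒i≤j+k : ∀ {i j k} → i - j ≤ k → i ≤ j + k
i-j≤k⇒i≤j+k {i} {j} {k} i-j≤k = begin
  i            ≡⟨ split i j ⟩
  j + (i - j)  ≤⟨ +-monoʳ-≤ j i-j≤k ⟩
  j + k        ∎
  where
  open ≤-Reasoning
  split : ∀ i j → i ≡ j + (i - j)
  split = solve-∀

i-1≡pred[i] : ∀ i → i - 1ℤ ≡ pred i
i-1≡pred[i] i = +-comm i _

[i-1]+j≡[i+j]-1 : ∀ i j → (i - 1ℤ) + j ≡ (i + j) - 1ℤ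
[i-1]+j≡[i+j]-1 = solve-∀

record Falling {m : ℕ} (ℓ : ℕ) (B : ℤ) (x : Vector ℤ (suc m)) : Set where
  constructor falling
  field
    {c}      : ℤ
    multiple : + ℓ ∣ c
    below    : c ≤ head x
    spread   : last x ≤ c + B

-- The witness `j` may be any multiple, not only the pivot: minimality of the pivot transfers the
-- bound `near` to it whenever a move is made.
record Settled {m : ℕ} (ℓ : ℕ) (B : ℤ) (x : Vector ℤ (suc m)) : Set where
  constructor settled
  field
    {j}      : Fin (suc m)
    multiple : + ℓ ∣ x j
    near     : x j ≤ head x + + ℓ
    spread   : last x ≤ head x + B

module _ {n ℓ : ℕ} {x x′ : Vector ℤ n} (move : GMMove ℓ x x′) where

  private
    i       = proj₁ move
    keeps   = proj₁ (proj₂ (proj₂ move))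
    lowers  = proj₂ (proj₂ (proj₂ move))

  move-≤ : ∀ k → x′ k ≤ x k
  move-≤ k with k ≟ i
  ... | yes refl = ≤-reflexive keeps
  ... | no k≢i   = ≤-trans (≤-reflexive (lowers k k≢i)) (i-j≤i (x k) 1ℤ)

  pred-≤-move : ∀ k → x k - 1ℤ ≤ x′ k
  pred-≤-move k with k ≟ i
  ... | yes refl = ≤-trans (i-j≤i (x k) 1ℤ) (≤-reflexive (sym keeps))
  ... | no k≢i   = ≤-reflexive (sym (lowers k k≢i))

module _ {m ℓ : ℕ} {B : ℤ} .{{_ : ℕ.NonZero ℓ}} (ℓ≤B : + ℓ ≤ B) where

  -- The new witness is the pivot `i` of the old vector: the move leaves this entry alone, so it is
  -- still a multiple of `ℓ`.
  settled-step : {x x′ : Vector ℤ (suc m)} → GMMove ℓ x x′ → Settled ℓ B x → Settled ℓ B x′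
  settled-step {x} {x′} move@(i , pivot , keeps , lowers) (settled {j} ℓ∣xⱼ near spread)
    with Fin.zero ≟ i
  -- The first entry is the pivot and stays put, while the last entry cannot rise.
  ... | yes refl = settled ℓ∣x′ᵢ (i≤i+j (x′ i) (+ ℓ))
                     (≤-trans (move-≤ move (fromℕ m))
                       (subst (λ h → last x ≤ h + B) (sym keeps) spread))
    where
    ℓ∣x′ᵢ : + ℓ ∣ x′ i
    ℓ∣x′ᵢ = subst (+ ℓ ∣_) (sym keeps) (IsPivot.multiple pivot)
  ... | no 0≢i = settled ℓ∣x′ᵢ near′ spread′
    where
    open ≤-Reasoning
    open IsPivot pivot

    ℓ∣x′ᵢ : + ℓ ∣ x′ i
    ℓ∣x′ᵢ = subst (+ ℓ ∣_) (sym keeps) multiple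

    shift : ∀ k → (head x + k) - 1ℤ ≡ head x′ + k
    shift k = trans (sym ([i-1]+j≡[i+j]-1 (head x) k)) (cong (_+ k) (sym (lowers Fin.zero 0≢i)))

    xᵢ≢x₁+ℓ : x i ≢ head x + + ℓ
    xᵢ≢x₁+ℓ eq = <⇒≱ x₁<xᵢ (minimal Fin.zero ℓ∣x₁)
      where
      ℓ∣x₁ : + ℓ ∣ head x
      ℓ∣x₁ = ∣m+n∣n⇒∣m (subst (+ ℓ ∣_) eq multiple) ∣-refl
      x₁<xᵢ : head x < x i
      x₁<xᵢ = begin-strict
        head x        ≡⟨ +-identityʳ (head x) ⟨
        head x + 0ℤ   <⟨ +-monoʳ-< (head x) (ℤ.+<+ (ℕ.>-nonZero⁻¹ ℓ)) ⟩
        head x + + ℓ  ≡⟨ eq ⟨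
        x i           ∎

    near′ : x′ i ≤ head x′ + + ℓ
    near′ = begin
      x′ i                 ≡⟨ keeps ⟩
      -- Excluding equality gains exactly the unit that the first entry loses in this move.
      x i                  ≤⟨ i<j⇒i≤pred[j] (≤∧≢⇒< (≤-trans (minimal j ℓ∣xⱼ) near) xᵢ≢x₁+ℓ) ⟩
      pred (head x + + ℓ)  ≡⟨ i-1≡pred[i] (head x + + ℓ) ⟨
      (head x + + ℓ) - 1ℤ  ≡⟨ shift (+ ℓ) ⟩
      head x′ + + ℓ        ∎

    spread′ : last x′ ≤ head x′ + B
    spread′ with fromℕ m ≟ i
    -- The last entry is itself the pivot, so `near′` already bounds it, whatever the old spread
    -- was.
    ... | yes refl = ≤-trans near′ (+-monoʳ-≤ (head x′) ℓ≤B)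
    ... | no n≢i   = begin
      last x′          ≡⟨ lowers (fromℕ m) n≢i ⟩
      last x - 1ℤ      ≤⟨ +-monoˡ-≤ _ spread ⟩
      head x + B - 1ℤ  ≡⟨ shift B ⟩
      head x′ + B      ∎

  falling-step : {x x′ : Vector ℤ (suc m)} → GMMove ℓ x x′ → Falling ℓ B x →
                 Falling ℓ B x′ ⊎ Settled ℓ B x′
  falling-step {x} {x′} move (falling {c} ℓ∣c below spread) with c ℤ.≟ head x
  -- Here the first entry equals `c`, so it serves as the witness before the move.
  ... | yes refl = inj₂ (settled-step move (settled {j = Fin.zero} ℓ∣c (i≤i+j c (+ ℓ)) spread))
  -- The first entry lies strictly above `c`, and a drop of at most one cannot take it past `c`.
  ... | no c≢x₁  = inj₁ (falling ℓ∣c below′ (≤-trans (move-≤ move (fromℕ m)) spread))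
    where
    open ≤-Reasoning
    below′ : c ≤ head x′
    below′ = begin
      c              ≤⟨ i<j⇒i≤pred[j] (≤∧≢⇒< below c≢x₁) ⟩
      pred (head x)  ≡⟨ i-1≡pred[i] (head x) ⟨
      head x - 1ℤ    ≤⟨ pred-≤-move move Fin.zero ⟩
      head x′        ∎

  settled-range : {x x′ : Vector ℤ (suc m)} → GMMoves ℓ x x′ → Settled ℓ B x → range x′ ≤ B
  settled-range ε              s = i≤j+k⇒i-j≤k (Settled.spread s)
  settled-range (move ◅ moves) s = settled-range moves (settled-step move s)

  falling-range : {x x′ : Vector ℤ (suc m)} → GMMoves ℓ x x′ → Falling ℓ B x → range x′ ≤ B
  falling-range ε              f = i≤j+k⇒i-j≤k (≤-trans (Falling.spread f) (+-monoˡ-≤ B (Falling.below f)))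
  falling-range (move ◅ moves) f = [ falling-range moves , settled-range moves ]′ (falling-step move f)

lemma1 : (m ℓ : ℕ) → 2 ℕ.≤ ℓ →
    (x x′ : Vector ℤ (suc m)) →
    Sorted x → HasMultiple ℓ x → GMMoves ℓ x x′ →
    (range x ≤ + ℓ → range x′ ≤ + ℓ) × (range x′ - range x ≤ + ℓ)
lemma1 m ℓ@(suc _) 2≤ℓ x x′ sorted (j , ℓ∣xⱼ) moves = bounded , increase
  where
  open ≤-Reasoning

  bounded : range x ≤ + ℓ → range x′ ≤ + ℓ
  bounded r≤ℓ = settled-range ≤-refl moves
    -- With range at most `ℓ`, every entry lies within `ℓ` of the first, so any multiple is a
    -- witness from the start.
    (settled ℓ∣xⱼ (≤-trans (sorted (≤fromℕ j)) xₙ≤x₁+ℓ) xₙ≤x₁+ℓ)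
    where
    xₙ≤x₁+ℓ : last x ≤ head x + + ℓ
    xₙ≤x₁+ℓ = i-j≤k⇒i≤j+k r≤ℓ

  increase : range x′ - range x ≤ + ℓ
  increase = i≤j+k⇒i-j≤k (falling-range ℓ≤r+ℓ moves
    (falling (divides q refl) ([n/ℕd]*d≤n (head x) ℓ) spread))
    where
    q = head x /ℕ ℓ

    ℓ≤r+ℓ : + ℓ ≤ range x + + ℓ
    ℓ≤r+ℓ = i≤j+i (+ ℓ) (range x) {{nonNegative (i≤j⇒0≤j-i (sorted {Fin.zero} {fromℕ m} z≤n))}}

    regroup : ∀ l q r → (l + q * l) + r ≡ q * l + (r + l)
    regroup = solve-∀

    spread : last x ≤ q * + ℓ + (range x + + ℓ)
    spread = begin
      last x                       ≤⟨ i-j≤k⇒i≤j+k {j = head x} ≤-refl ⟩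
      -- Rounding the first entry down to `q * + ℓ` loses less than `ℓ`, which is the extra `ℓ` in
      -- the bound.
      head x + range x             ≤⟨ +-monoˡ-≤ (range x) (<⇒≤ (n<s[n/ℕd]*d (head x) ℓ)) ⟩
      ℤ.suc q * + ℓ + range x      ≡⟨ cong (_+ range x) (suc-* q (+ ℓ)) ⟩
      (+ ℓ + q * + ℓ) + range x    ≡⟨ regroup (+ ℓ) q (range x) ⟩
      q * + ℓ + (range x + + ℓ)    ∎
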